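{- Let $G$ be a graph with $n$ vertices, $m$ edges and maximum degree $d$. Every $(\geqslant n2^m)$-subdivision of $G$ has stretch-width at most $32(4d+5)^3$.
   Context: For an integer $s$, a $(\geqslant s)$-subdivision of $G$ is any graph obtained from $G$ by subdividing each edge at least $s$ times (i.e., replacing each edge by a path with at least $s$ internal vertices, these paths being internally disjoint). Stretch-width: a partition sequence of an $N$-vertex graph $H$ is a sequence $\mathcal P_N,\dots,\mathcal P_1$ of partitions of $V(H)$ with $\mathcal P_N$ the singleton partition, $\mathcal P_1=\{V(H)\}$, each $\mathcal P_i$ obtained from $\mathcal P_{i+1}$ by merging two parts. Distinct parts $X,Y$ are inhomogeneous if there are $u,u'\in X$, $v,v'\in Y$ with $uv\in E(H)$, $u'v'\notin E(H)$; the red graph $\mathcal R(\mathcal P)$ has vertex set $\mathcal P$ and edges between inhomogeneous parts. For a total order $\prec$ on $V(H)$, the span of $X\subseteq V(H)$ is $\langle X\rangle=\{v:\min X\preceq v\preceq \max X\}$, and $X,Y$ conflict if their spans intersect. For $X\in\mathcal P$, $Y\in\mathcal P\setminus\{X\}$ interferes with $X$ if $Y$ conflicts with the union of the parts in the closed neighborhood of $X$ in $\mathcal R(\mathcal P)$; the stretch of $X$ is the number of parts interfering with it, and the stretch of $\mathcal P$ is the maximum over parts. $\mathrm{stw}(H,\prec)$ is the minimum over partition sequences of the maximum stretch of its partitions; $\mathrm{stw}(H)=\min_\prec\mathrm{stw}(H,\prec)$. -}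

module Defs where

open import Data.Nat using (ℕ; zero; suc; _+_; _≤_; _<_; _≤ᵇ_; _⊔_; _<?_)
open import Data.Bool using (Bool; true; false; _∧_; _∨_; not; T; if_then_else_)
open import Data.Fin using (Fin; zero; suc; toℕ; fromℕ<) renaming (_<_ to _<ᶠ_)
import Data.Fin as F
open import Data.Fin.Permutation using (Permutation′; _⟨$⟩ʳ_)
open import Data.Product using (Σ; ∃; ∃-syntax; _×_; _,_)
open import Data.Sum using (_⊎_; inj₁; inj₂)
open import Relation.Binary.PropositionalEquality using (_≡_)
open import Relation.Nullary using (¬_; yes; no)
open import Relation.Nullary.Decidable using (⌊_⌋)
open import Function.Bundles using (_↔_; _⇔_; Inverse)

record Graph : Set where
  field
    size   : ℕ
    adj    : Fin size → Fin size → Bool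
    sym    : ∀ u v → adj u v ≡ adj v u
    irrefl : ∀ u → adj u u ≡ false
open Graph public

anyFin : ∀ {n} → (Fin n → Bool) → Bool
anyFin {zero}  p = false
anyFin {suc n} p = p zero ∨ anyFin (λ i → p (suc i))

sumFin : ∀ {n} → (Fin n → ℕ) → ℕ
sumFin {zero}  f = 0
sumFin {suc n} f = f zero + sumFin (λ i → f (suc i))

countFin : ∀ {n} → (Fin n → Bool) → ℕ
countFin p = sumFin (λ i → if p i then 1 else 0)

maxFin : ∀ {n} → (Fin n → ℕ) → ℕ
maxFin {zero}  f = 0
maxFin {suc n} f = f zero ⊔ maxFin (λ i → f (suc i))

_==_ : ∀ {n} → Fin n → Fin n → Bool
a == b = ⌊ a F.≟ b ⌋

numEdges : Graph → ℕ
numEdges G = sumFin λ u → countFin λ v → ⌊ u F.<? v ⌋ ∧ adj G u v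

degree : (G : Graph) → Fin (size G) → ℕ
degree G v = countFin (adj G v)

maxDegree : Graph → ℕ
maxDegree G = maxFin (degree G)

record Edge (G : Graph) : Set where
  constructor edge
  field
    src   : Fin (size G)
    tgt   : Fin (size G)
    lt    : src <ᶠ tgt
    isAdj : T (adj G src tgt)
open Edge public

SubVert : (G : Graph) → (Edge G → ℕ) → Set
SubVert G ℓ = Fin (size G) ⊎ Σ (Edge G) (λ e → Fin (ℓ e))

-- the j-th vertex (j = 0 .. ℓ e + 1) of the path replacing e:
-- position 0 is src e, positions 1..ℓ e are the new vertices, ℓ e + 1 is tgt e
pathVert : (G : Graph) (ℓ : Edge G → ℕ) → (e : Edge G) → ℕ → SubVert G ℓ
pathVert G ℓ e zero = inj₁ (src e)
pathVert G ℓ e (suc j) with j <? ℓ e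
... | yes p = inj₂ (e , fromℕ< p)
... | no _  = inj₁ (tgt e)

SubAdj : (G : Graph) (ℓ : Edge G → ℕ) → SubVert G ℓ → SubVert G ℓ → Set
SubAdj G ℓ x y =
  ∃[ e ] ∃[ j ] (j ≤ ℓ e) ×
    ((x ≡ pathVert G ℓ e j × y ≡ pathVert G ℓ e (suc j))
     ⊎ (y ≡ pathVert G ℓ e j × x ≡ pathVert G ℓ e (suc j)))

IsSubdivisionAtLeast : ℕ → Graph → Graph → Set
IsSubdivisionAtLeast s G H =
  Σ (Edge G → ℕ) λ ℓ → (∀ e → s ≤ ℓ e) ×
  Σ (Fin (size H) ↔ SubVert G ℓ) λ f →
    ∀ x y → (T (adj H x y) ⇔ SubAdj G ℓ (Inverse.to f x) (Inverse.to f y))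

-- Stretch-width
-- Throughout: H a graph, N = size H, the total order ≺ on V(H) is given by
-- a permutation σ (rank): u ⪯ v iff σ u ≤ σ v.
-- A partition with k parts is given by a labelling c : Fin N → Fin k
-- (the parts are the fibres c⁻¹(a); surjectivity is required where used).

module _ (H : Graph) where
  private N = size H

  _⪯_ : Permutation′ N → Fin N → Fin N → Bool
  _⪯_ σ u v = toℕ (σ ⟨$⟩ʳ u) ≤ᵇ toℕ (σ ⟨$⟩ʳ v)

  -- v ∈ ⟨X⟩, i.e. min X ⪯ v ⪯ max X, for X given by a Boolean predicate
  inSpan : Permutation′ N → (Fin N → Bool) → Fin N → Bool
  inSpan σ X v = anyFin (λ x → X x ∧ _⪯_ σ x v) ∧ anyFin (λ x → X x ∧ _⪯_ σ v x)

  conflict : Permutation′ N → (Fin N → Bool) → (Fin N → Bool) → Bool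
  conflict σ X Y = anyFin (λ v → inSpan σ X v ∧ inSpan σ Y v)

  module _ {k : ℕ} (c : Fin N → Fin k) where
    part : Fin k → Fin N → Bool
    part a x = c x == a

    -- parts a, b are inhomogeneous (intended for a ≠ b)
    inhom : Fin k → Fin k → Bool
    inhom a b =
      anyFin (λ u → anyFin (λ v → part a u ∧ part b v ∧ adj H u v)) ∧
      anyFin (λ u → anyFin (λ v → part a u ∧ part b v ∧ not (adj H u v)))

    -- b lies in the closed neighbourhood of a in the red graph
    closedNbr : Fin k → Fin k → Bool
    closedNbr a b = (b == a) ∨ inhom a b

    nbrUnion : Fin k → Fin N → Bool
    nbrUnion a x = closedNbr a (c x)

    interferes : Permutation′ N → Fin k → Fin k → Bool
    interferes σ a b = not (b == a) ∧ conflict σ (part b) (nbrUnion a)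

    stretchPart : Permutation′ N → Fin k → ℕ
    stretchPart σ a = countFin (interferes σ a)

    stretch : Permutation′ N → ℕ
    stretch σ = maxFin (stretchPart σ)

  MergeOf : ∀ {k k'} → (Fin N → Fin k) → (Fin N → Fin k') → Set
  MergeOf {k} c c' = Σ (Fin k) λ a → Σ (Fin k) λ b → ¬ (a ≡ b) ×
    (∀ x y → (c' x ≡ c' y) ⇔
       ((c x ≡ c y) ⊎ ((c x ≡ a × c y ≡ b) ⊎ (c x ≡ b × c y ≡ a))))

  -- a partition sequence P_N, …, P_1: P i is the partition 𝒫_{i+1}
  -- (with i+1 parts), for i < N
  record PartitionSequence : Set where
    field
      P        : (i : ℕ) → Fin N → Fin (suc i)
      surj     : ∀ i → suc i ≤ N → ∀ (a : Fin (suc i)) → ∃[ x ] P i x ≡ a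
      singleton : ∀ i → suc i ≡ N → ∀ x y → P i x ≡ P i y → x ≡ y
      merge    : ∀ i → suc (suc i) ≤ N → MergeOf (P (suc i)) (P i)
  -- (𝒫_1 = {V(H)} holds automatically since P 0 has codomain Fin 1)

  StwOrdAtMost : Permutation′ N → ℕ → Set
  StwOrdAtMost σ w = Σ PartitionSequence λ S →
    ∀ i → suc i ≤ N → stretch (PartitionSequence.P S i) σ ≤ w

  StwAtMost : ℕ → Set
  StwAtMost w = Σ (Permutation′ N) λ σ → StwOrdAtMost σ w

{-# OPTIONS --safe #-}
module Submission where

-- The vertices of H are placed on a line carrying a dyadic grid. A branch vertex v sits at
-- v · 2^m, and the path of the edge with index ρ < m walks monotonically from one end to the other
-- through the odd multiples of 2^ρ; the vertices left over once it has arrived form a run at its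
-- last position. Distinct paths thus occupy distinct positions, and in a grid cell of length 2^r
-- all the vertices of level ≥ r share the left end of the cell, since level ρ means that the
-- position is divisible by 2^ρ.
--
-- First the inner vertices of the runs are merged, in path order. Then, for r = 0, 1, 2, …, the
-- vertices of level < r lying in a common cell of length 2^r form one part (a bundle), while the
-- other vertices outside the runs are still singletons. Two singletons are always homogeneous, so
-- long edges between singletons are never red, and every other edge joins vertices in equal or
-- adjacent cells. As a cell meets a bounded number of parts, the stretch of all these partitions,
-- and of those interpolating between them, is at most 72, whatever the degree.

open import Defs hiding (sym)
open import Data.Bool using (Bool; true; false; T; if_then_else_; _∧_; not)
open import Data.Bool.Properties using (T-∧; T-∨; T-irrelevant)
open import Data.Empty using (⊥; ⊥-elim)
open import Data.Fin using (Fin; zero; suc; toℕ; fromℕ<; punchIn; punchOut; _≟_; combine)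
import Data.Fin as F
open import Data.Fin.Patterns using (0F; 1F; 2F; 3F)
open import Data.Fin.Permutation using (Permutation′; _⟨$⟩ʳ_; insert) renaming (id to idₚ)
open import Data.Fin.Properties
  using (toℕ-injective; toℕ-fromℕ<; fromℕ<-injective; toℕ<n; injective⇒≤; combine-injective; any?;
         punchOut-injective; punchOut-cong; punchOut-punchIn; punchIn-punchOut; punchInᵢ≢i)
import Data.Fin.Properties as Fin
open import Data.Nat
  using (ℕ; zero; suc; pred; _+_; _*_; _∸_; _^_; _⊔_; _⊓_; ⌊_/2⌋; _≤_; _<_; _≤?_; _<?_;
         z≤n; s≤s; z<s; >-nonZero)
import Data.Nat as ℕ
open import Data.Nat.Properties hiding (_≟_; _≤?_; _<?_)
open import Data.Product using (Σ; ∃; ∃₂; _×_; _,_; proj₁; proj₂)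
open import Data.Sum using (_⊎_; inj₁; inj₂; [_,_]′)
import Data.Sum as Sum
open import Function using (_∘_; id)
open import Function.Bundles using (_⇔_; mk⇔; Equivalence; Inverse; Injection; _↔_)
open import Function.Properties.Inverse using (↔⇒↣)
open import Relation.Binary using (tri<; tri≈; tri>)
open import Relation.Binary.PropositionalEquality
  using (_≡_; refl; sym; trans; cong; cong₂; subst; subst₂; module ≡-Reasoning)
open import Relation.Nullary using (¬_; Dec; yes; no; contradiction)
open import Relation.Nullary.Decidable using (toWitness; fromWitness; map′; _×-dec_; ¬?; ⌊_⌋)

-- Finite sets: counting, minimisation and sorting.

private variable
  n : ℕ

T-∧⁻ : ∀ a {b} → T (a ∧ b) → T a × T b
T-∧⁻ a = Equivalence.to (T-∧ {a})

anyFin⁻ : (p : Fin n → Bool) → T (anyFin p) → ∃ λ i → T (p i)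
anyFin⁻ {suc n} p h with Equivalence.to (T-∨ {p zero}) h
... | inj₁ h₀ = zero , h₀
... | inj₂ h₁ with anyFin⁻ (p ∘ suc) h₁
...   | i , hi = suc i , hi

anyFin-∧⁻ : (p : Fin n → Bool) {q : Fin n → Bool} →
  T (anyFin λ i → p i ∧ q i) → ∃ λ i → T (p i) × T (q i)
anyFin-∧⁻ p h with anyFin⁻ _ h
... | i , hi = i , T-∧⁻ (p i) hi

==⇒≡ : {a b : Fin n} → T (a == b) → a ≡ b
==⇒≡ {a = a} {b} h = toWitness {a? = a ≟ b} h

T-not : ∀ {a} → T (not a) → ¬ T a
T-not {false} _ ()

maxFin-lub : (f : Fin n → ℕ) (w : ℕ) → (∀ i → f i ≤ w) → maxFin f ≤ w
maxFin-lub {zero} f w h = z≤n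
maxFin-lub {suc n} f w h = ⊔-lub (h zero) (maxFin-lub (f ∘ suc) w (h ∘ suc))

≤-maxFin : (f : Fin n → ℕ) (i : Fin n) → f i ≤ maxFin f
≤-maxFin f zero = m≤m⊔n _ _
≤-maxFin f (suc i) = ≤-trans (≤-maxFin (f ∘ suc) i) (m≤n⊔m (f zero) _)

enumerate : (p : Fin n → Bool) → Σ (Fin (countFin p) → Fin n) λ f →
  (∀ i → T (p (f i))) × (∀ i j → f i ≡ f j → i ≡ j)
enumerate {zero} p = (λ ()) , (λ ()) , λ ()
enumerate {suc n} p with p zero in eq | enumerate (p ∘ suc)
... | false | f , pf , f-inj = suc ∘ f , pf , λ i j e → f-inj i j (Fin.suc-injective e)
... | true | f , pf , f-inj = g , pg , g-inj
  where
  g : Fin (suc _) → Fin (suc n)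
  g zero = zero
  g (suc i) = suc (f i)
  pg : ∀ i → T (p (g i))
  pg zero = subst T (sym eq) _
  pg (suc i) = pf i
  g-inj : ∀ i j → g i ≡ g j → i ≡ j
  g-inj zero zero _ = refl
  g-inj zero (suc _) ()
  g-inj (suc _) zero ()
  g-inj (suc i) (suc j) e = cong suc (f-inj i j (Fin.suc-injective e))

countFin-≤ : (p : Fin n → Bool) {K : ℕ} (h : ∀ i → T (p i) → Fin K) →
  (∀ i j pi pj → h i pi ≡ h j pj → i ≡ j) → countFin p ≤ K
countFin-≤ p h inj with enumerate p
... | f , pf , f-inj = injective⇒≤ {f = λ j → h (f j) (pf j)}
  (λ {i} {j} e → f-inj i j (inj _ _ _ _ e))

argmin : (key : Fin (suc n) → ℕ) → ∃ λ i → ∀ j → key i ≤ key j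
argmin {zero} key = zero , λ { zero → ≤-refl }
argmin {suc n} key with argmin (key ∘ suc)
... | i , i-min with ≤-total (key zero) (key (suc i))
...   | inj₁ h = zero , λ { zero → ≤-refl ; (suc j) → ≤-trans h (i-min j) }
...   | inj₂ h = suc i , λ { zero → h ; (suc j) → i-min j }

-- Selection sort: a minimiser gets rank zero and the rest is sorted recursively. Ties are broken
-- arbitrarily, so only the implication from ranks to keys can hold.
sortBy : (key : Fin n → ℕ) → Σ (Permutation′ n) λ σ →
  ∀ x y → toℕ (σ ⟨$⟩ʳ x) ≤ toℕ (σ ⟨$⟩ʳ y) → key x ≤ key y
sortBy {zero} key = idₚ , λ ()
sortBy {suc n} key with argmin key
... | i , i-min with sortBy (key ∘ punchIn i)
...   | τ , τ-mono = insert i zero τ , mono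
  where
  mono : ∀ x y → toℕ (insert i zero τ ⟨$⟩ʳ x) ≤ toℕ (insert i zero τ ⟨$⟩ʳ y) → key x ≤ key y
  mono x y with i ≟ x | i ≟ y
  ... | yes refl | _ = λ _ → i-min y
  ... | no _ | yes _ = λ ()
  ... | no i≢x | no i≢y = λ { (s≤s h) →
    subst (λ a → key a ≤ key y) (punchIn-punchOut i≢x)
      (subst (λ a → key (punchIn i (punchOut i≢x)) ≤ key a) (punchIn-punchOut i≢y)
        (τ-mono _ _ h)) }

-- Partition sequences whose stretch is controlled by cells.

Close : ℕ → ℕ → Set
Close a b = a ≤ suc b × b ≤ suc a

Close-sym : ∀ {a b} → Close a b → Close b a
Close-sym (h , h′) = h′ , h

module Contraction (H : Graph) (σ : Permutation′ (size H)) (w : ℕ) where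
  private
    N = size H
    V = Fin N

  Alone : {A : Set} → (V → A) → V → Set
  Alone f x = ∀ y → f y ≡ f x → y ≡ x

  -- Stated for a pair Q (fine), Q′ (coarse) so that it applies to every partition in between:
  -- the parts of Q in a cell are told apart by their codes, so a cell meets at most s parts.
  record Cells {A B : Set} (s : ℕ) (Q : V → A) (Q′ : V → B) : Set where
    field
      cell   : V → ℕ
      code   : V → Fin s
      mono   : ∀ x y → toℕ (σ ⟨$⟩ʳ x) ≤ toℕ (σ ⟨$⟩ʳ y) → cell x ≤ cell y
      within : ∀ x y → Q′ x ≡ Q′ y → cell x ≡ cell y
      coded  : ∀ x y → cell x ≡ cell y → code x ≡ code y → Q x ≡ Q y
      local  : ∀ x y → T (adj H x y) → Close (cell x) (cell y) ⊎ (Alone Q′ x × Alone Q′ y)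

  module _ {A B : Set} {s : ℕ} {Q : V → A} {Q′ : V → B} (cells : Cells s Q Q′)
           {k : ℕ} (c : V → Fin k)
           (Q⇒c : ∀ x y → Q x ≡ Q y → c x ≡ c y) (c⇒Q′ : ∀ x y → c x ≡ c y → Q′ x ≡ Q′ y) where
    open Cells cells

    private
      ⪯⇒cell≤ : ∀ {x y} → T (_⪯_ H σ x y) → cell x ≤ cell y
      ⪯⇒cell≤ h = mono _ _ (≤ᵇ⇒≤ _ _ h)

      part⇒cell : ∀ u x → T (part H c (c x) u) → cell u ≡ cell x
      part⇒cell u x h = within u x (c⇒Q′ u x (==⇒≡ h))

      -- Inhomogeneity supplies an edge and a non-edge between the two parts. If the edge is not
      -- local, both its ends are alone in their parts, so the non-edge is the same pair, a
      -- contradiction.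
      inhom⇒Close : ∀ {x y} → T (inhom H c (c x) (c y)) → Close (cell y) (cell x)
      inhom⇒Close {x} {y} h
        with T-∧⁻ (anyFin λ u → anyFin λ v → part H c (c x) u ∧ part H c (c y) v ∧ adj H u v) h
      ... | some , notAll with anyFin⁻ _ some | anyFin⁻ _ notAll
      ... | u , hu | u′ , hu′ with anyFin⁻ _ hu | anyFin⁻ _ hu′
      ... | v , uv | v′ , u′v′
        with T-∧⁻ (part H c (c x) u) uv | T-∧⁻ (part H c (c x) u′) u′v′
      ... | pu , r | pu′ , r′ with T-∧⁻ (part H c (c y) v) r | T-∧⁻ (part H c (c y) v′) r′
      ... | pv , auv | pv′ , ¬au′v′ with local u v auv
      ...   | inj₁ cl = Close-sym
        (subst (λ a → Close a (cell y)) (part⇒cell u x pu)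
          (subst (Close (cell u)) (part⇒cell v y pv) cl))
      ...   | inj₂ (alone-u , alone-v)
        with alone-u u′ (c⇒Q′ u′ u (trans (==⇒≡ pu′) (sym (==⇒≡ pu))))
           | alone-v v′ (c⇒Q′ v′ v (trans (==⇒≡ pv′) (sym (==⇒≡ pv))))
      ...   | refl | refl = ⊥-elim (T-not ¬au′v′ auv)

      closedNbr⇒Close : ∀ {x y} → T (closedNbr H c (c x) (c y)) → Close (cell y) (cell x)
      closedNbr⇒Close {x} {y} h with Equivalence.to (T-∨ {c y == c x}) h
      ... | inj₁ h = subst (Close (cell y)) (part⇒cell y x h) (n≤1+n _ , n≤1+n _)
      ... | inj₂ h = inhom⇒Close h

      inSpan⁻ : ∀ X {v} → T (inSpan H σ X v) →
        ∃₂ λ x y → (T (X x) × cell x ≤ cell v) × (T (X y) × cell v ≤ cell y)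
      inSpan⁻ X {v} h with T-∧⁻ (anyFin λ x → X x ∧ _⪯_ H σ x v) h
      ... | lo , hi with anyFin-∧⁻ X lo | anyFin-∧⁻ X hi
      ... | x , Xx , x⪯v | y , Xy , v⪯y = x , y , (Xx , ⪯⇒cell≤ x⪯v) , (Xy , ⪯⇒cell≤ v⪯y)

      -- Cells are monotone along the order. The span of a part therefore stays in one cell, and
      -- that of the closed red neighbourhood of `c x` in the cells within one of `cell x`; a common
      -- vertex puts the interfering part there too.
      interferes⇒Close : ∀ {x b} → T (interferes H c σ (c x) b) →
        ∃ λ y → c y ≡ b × Close (cell y) (cell x)
      interferes⇒Close {x} {b} h
        with anyFin-∧⁻ (inSpan H σ (part H c b)) (proj₂ (T-∧⁻ (not (b == c x)) h))
      ... | v , v∈b , v∈U with inSpan⁻ (part H c b) v∈b | inSpan⁻ (nbrUnion H c (c x)) v∈U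
      ... | y₁ , y₂ , (p₁ , y₁≤v) , (p₂ , v≤y₂) | z₁ , z₂ , (q₁ , z₁≤v) , (q₂ , v≤z₂) =
        y₁ , ==⇒≡ p₁ ,
        ≤-trans y₁≤v (≤-trans v≤z₂ (proj₁ (closedNbr⇒Close q₂))) ,
        ≤-trans (proj₂ (closedNbr⇒Close q₁)) (s≤s (≤-trans z₁≤v (≤-trans v≤y₂ (≤-reflexive
          (within y₂ y₁ (c⇒Q′ y₂ y₁ (trans (==⇒≡ p₂) (sym (==⇒≡ p₁)))))))))

      -- The shift by one keeps the truncated subtraction exact, because `b ≤ suc a`.
      offset : ∀ {a b} → Close a b → Fin 3
      offset {a} {b} (a≤1+b , _) = fromℕ< {suc a ∸ b}
        (s≤s (≤-trans (∸-monoˡ-≤ b (s≤s a≤1+b)) (≤-reflexive (m+n∸n≡m 2 b))))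

      offset-injective : ∀ {a a′ b} (h : Close a b) (h′ : Close a′ b) → offset h ≡ offset h′ → a ≡ a′
      offset-injective (_ , b≤1+a) (_ , b≤1+a′) e =
        suc-injective (∸-cancelʳ-≡ b≤1+a b≤1+a′ (fromℕ<-injective _ _ _ _ e))

    -- Three cells can host an interfering part. Cell and code of a representative determine its
    -- part of `Q`, hence its part of `c`, so pairs of offset and code count the interfering parts.
    stretchPart-≤ : ∀ x → stretchPart H c σ (c x) ≤ 3 * s
    stretchPart-≤ x = countFin-≤ _
      (λ b h → let y , _ , cl = interferes⇒Close h in combine (offset cl) (code y))
      λ b b′ h h′ e →
        let y  , cy≡b   , cl  = interferes⇒Close {x} h
            y′ , cy′≡b′ , cl′ = interferes⇒Close {x} h′
            off≡ , code≡ = combine-injective (offset cl) _ (offset cl′) _ e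
        in trans (sym cy≡b) (trans
             (Q⇒c y y′ (coded y y′ (offset-injective cl cl′ off≡) code≡)) cy′≡b′)

    stretch-≤ : (∀ a → ∃ λ x → c x ≡ a) → 3 * s ≤ w → stretch H c σ ≤ w
    stretch-≤ surj 3s≤w = maxFin-lub _ w λ a →
      let x , cx≡a = surj a
      in ≤-trans (subst (λ a → stretchPart H c σ a ≤ 3 * s) cx≡a (stretchPart-≤ x)) 3s≤w

  Onto : ∀ {k} → (V → Fin k) → Set
  Onto c = ∀ a → ∃ λ x → c x ≡ a

  -- A sequence indexed by its coarsest partition so far, so that it can be extended one merge at a
  -- time; `at` turns it into the function that `PartitionSequence` asks for.
  data Merges : ∀ {k} → (V → Fin (suc k)) → Set where
    start : ∀ {k} {c : V → Fin (suc k)} → suc k ≡ N → (∀ x y → c x ≡ c y → x ≡ y) →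
      Onto c → stretch H c σ ≤ w → Merges c
    step : ∀ {k} {c : V → Fin (suc (suc k))} {c′ : V → Fin (suc k)} → Merges c →
      MergeOf H c c′ → Onto c′ → stretch H c′ σ ≤ w → Merges c′

  Merges⇒onto : ∀ {k} {c : V → Fin (suc k)} → Merges c → Onto c
  Merges⇒onto (start _ _ onto _) = onto
  Merges⇒onto (step _ _ onto _) = onto

  Merges⇒stretch : ∀ {k} {c : V → Fin (suc k)} → Merges c → stretch H c σ ≤ w
  Merges⇒stretch (start _ _ _ st) = st
  Merges⇒stretch (step _ _ _ st) = st

  Merges⇒≤ : ∀ {k} {c : V → Fin (suc k)} → Merges c → suc k ≤ N
  Merges⇒≤ (start e _ _ _) = ≤-reflexive e
  Merges⇒≤ (step s _ _ _) = <⇒≤ (Merges⇒≤ s)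

  at : ∀ {k} {c : V → Fin (suc k)} → Merges c → (i : ℕ) → V → Fin (suc i)
  at {k} {c} s i with k ℕ.≟ i
  at {c = c} _ i | yes refl = c
  -- Default for indices out of range; `at-Merges` and `at-merge` assume `k ≤ i` and an upper bound
  -- on `i` that exclude it.
  at (start _ _ _ _) i | no _ = λ _ → zero
  at (step s _ _ _) i | no _ = at s i

  at-last : ∀ {k} {c : V → Fin (suc k)} (s : Merges c) → at s k ≡ c
  at-last {k} s with k ℕ.≟ k
  ... | yes refl = refl
  ... | no k≢k = contradiction refl k≢k

  at-Merges : ∀ {k} {c : V → Fin (suc k)} (s : Merges c) {i} → k ≤ i → suc i ≤ N → Merges (at s i)
  at-Merges {k} s {i} k≤i i<N with k ℕ.≟ i
  at-Merges s k≤i i<N | yes refl = s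
  at-Merges (start refl _ _ _) k≤i i<N | no k≢i = contradiction (≤-antisym k≤i (≤-pred i<N)) k≢i
  at-Merges (step s _ _ _) k≤i i<N | no k≢i = at-Merges s (≤∧≢⇒< k≤i k≢i) i<N

  Merges⇒singleton : ∀ {k} {c : V → Fin (suc k)} → Merges c → suc k ≡ N → ∀ x y → c x ≡ c y → x ≡ y
  Merges⇒singleton (start _ inj _ _) _ = inj
  Merges⇒singleton (step s _ _ _) refl = contradiction (Merges⇒≤ s) 1+n≰n

  at-merge : ∀ {k} {c : V → Fin (suc k)} (s : Merges c) {i} → k ≤ i → suc (suc i) ≤ N →
    MergeOf H (at s (suc i)) (at s i)
  at-merge {k} s {i} k≤i i+1<N with k ℕ.≟ i
  at-merge (start refl _ _ _) k≤i i+1<N | yes refl = contradiction i+1<N 1+n≰n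
  at-merge {k} {c} (step s m _ _) k≤i i+1<N | yes refl with k ℕ.≟ suc k
  ... | yes ()
  ... | no _ = subst (λ d → MergeOf H d c) (sym (at-last s)) m
  at-merge (start refl _ _ _) k≤i i+1<N | no k≢i =
    contradiction (≤-trans (s≤s k≤i) (≤-pred i+1<N)) 1+n≰n
  at-merge {k} (step s _ _ _) {i} k≤i i+1<N | no k≢i with k ℕ.≟ suc i
  ... | yes refl = contradiction k≤i 1+n≰n
  ... | no _ = at-merge s (≤∧≢⇒< k≤i k≢i) i+1<N

  toStwOrdAtMost : {c : V → Fin 1} → Merges c → StwOrdAtMost H σ w
  toStwOrdAtMost s = record
    { P = at s
    ; surj = λ i i<N → Merges⇒onto (at-Merges s z≤n i<N)
    ; singleton = λ i e → Merges⇒singleton (at-Merges s z≤n (≤-reflexive e)) e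
    ; merge = λ i → at-merge s z≤n
    } , λ i i<N → Merges⇒stretch (at-Merges s z≤n i<N)

  -- Labels may come from any type: only the fibres of `Q` are compared with the parts.
  Reach : {A : Set} → (V → A) → Set
  Reach Q = ∃ λ k → Σ (V → Fin (suc k)) λ c → Merges c × (∀ x y → (c x ≡ c y) ⇔ (Q x ≡ Q y))

  module _ {A B : Set} {s : ℕ} {Q : V → A} {Q′ : V → B} (cells : Cells s Q Q′) (3s≤w : 3 * s ≤ w)
           (Q′-dec : ∀ x y → Dec (Q′ x ≡ Q′ y)) where

    -- As long as two parts lie in one class of `Q′`, which is tested on representatives, merge
    -- them. The new partition still lies between `Q` and `Q′`, so `stretch-≤` applies; when no such
    -- pair is left, the parts are the classes of `Q′`.
    coarsen : ∀ {k} {c : V → Fin (suc k)} → Merges c →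
      (∀ x y → Q x ≡ Q y → c x ≡ c y) → (∀ x y → c x ≡ c y → Q′ x ≡ Q′ y) → Reach Q′
    coarsen {k} {c} ms Q⇒c c⇒Q′
      with any? (λ a → any? (λ b → ¬? (a ≟ b) ×-dec
             Q′-dec (proj₁ (Merges⇒onto ms a)) (proj₁ (Merges⇒onto ms b))))
    ... | no none = k , c , ms , λ x y → mk⇔ (c⇒Q′ x y) (Q′⇒c x y)
      where
      Q′⇒c : ∀ x y → Q′ x ≡ Q′ y → c x ≡ c y
      Q′⇒c x y e with c x ≟ c y
      ... | yes cx≡cy = cx≡cy
      ... | no cx≢cy = ⊥-elim (none (c x , c y , cx≢cy ,
        trans (c⇒Q′ _ _ (proj₂ (Merges⇒onto ms (c x))))
          (trans e (sym (c⇒Q′ _ _ (proj₂ (Merges⇒onto ms (c y))))))))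
    coarsen {zero} ms Q⇒c c⇒Q′ | yes (zero , zero , 0≢0 , _) = contradiction refl 0≢0
    coarsen {suc k} {c} ms Q⇒c c⇒Q′ | yes (a , b , a≢b , Q′≡) =
      coarsen (step ms (a , b , a≢b , λ x y → mk⇔ (glue⁻ (c x) (c y)) (glue⁺ (c x) (c y)))
                 onto (stretch-≤ cells (glue ∘ c) Q⇒glue glue⇒Q′ onto 3s≤w))
        Q⇒glue glue⇒Q′
      where
      -- The name `b` is removed, and its part takes over the new name of `a`.
      glue : Fin (suc (suc k)) → Fin (suc k)
      glue p with b ≟ p
      ... | yes _ = punchOut (a≢b ∘ sym)
      ... | no b≢p = punchOut b≢p

      glue⁻ : ∀ p q → glue p ≡ glue q → p ≡ q ⊎ ((p ≡ a × q ≡ b) ⊎ (p ≡ b × q ≡ a))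
      glue⁻ p q e with b ≟ p | b ≟ q
      ... | yes refl | yes refl = inj₁ refl
      ... | yes refl | no b≢q = inj₂ (inj₂ (refl , sym (punchOut-injective _ b≢q e)))
      ... | no b≢p | yes refl = inj₂ (inj₁ (punchOut-injective b≢p _ e , refl))
      ... | no b≢p | no b≢q = inj₁ (punchOut-injective b≢p b≢q e)

      glue-ab : glue a ≡ glue b
      glue-ab with b ≟ a | b ≟ b
      ... | yes b≡a | _ = contradiction (sym b≡a) a≢b
      ... | no _ | yes _ = punchOut-cong b refl
      ... | no _ | no b≢b = contradiction refl b≢b

      glue⁺ : ∀ p q → p ≡ q ⊎ ((p ≡ a × q ≡ b) ⊎ (p ≡ b × q ≡ a)) → glue p ≡ glue q
      glue⁺ p q (inj₁ refl) = refl
      glue⁺ p q (inj₂ (inj₁ (refl , refl))) = glue-ab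
      glue⁺ p q (inj₂ (inj₂ (refl , refl))) = sym glue-ab

      glue-punchIn : ∀ j → glue (punchIn b j) ≡ j
      glue-punchIn j with b ≟ punchIn b j
      ... | yes e = contradiction (sym e) (punchInᵢ≢i b j)
      ... | no _ = trans (punchOut-cong b refl) (punchOut-punchIn b)

      onto : Onto (glue ∘ c)
      onto j with Merges⇒onto ms (punchIn b j)
      ... | x , e = x , trans (cong glue e) (glue-punchIn j)

      Q⇒glue : ∀ x y → Q x ≡ Q y → glue (c x) ≡ glue (c y)
      Q⇒glue x y e = cong glue (Q⇒c x y e)

      ab⇒Q′ : ∀ x y → c x ≡ a → c y ≡ b → Q′ x ≡ Q′ y
      ab⇒Q′ x y refl refl = trans (sym (c⇒Q′ _ _ (proj₂ (Merges⇒onto ms a))))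
        (trans Q′≡ (c⇒Q′ _ _ (proj₂ (Merges⇒onto ms b))))

      glue⇒Q′ : ∀ x y → glue (c x) ≡ glue (c y) → Q′ x ≡ Q′ y
      glue⇒Q′ x y e with glue⁻ (c x) (c y) e
      ... | inj₁ cx≡cy = c⇒Q′ x y cx≡cy
      ... | inj₂ (inj₁ (p , q)) = ab⇒Q′ x y p q
      ... | inj₂ (inj₂ (p , q)) = sym (ab⇒Q′ y x q p)

    Reach-coarsen : (∀ x y → Q x ≡ Q y → Q′ x ≡ Q′ y) → Reach Q → Reach Q′
    Reach-coarsen Q⇒Q′ (k , c , ms , eqv) = coarsen ms
      (λ x y → Equivalence.from (eqv x y)) (λ x y → Q⇒Q′ x y ∘ Equivalence.to (eqv x y))

  -- Each vertex is a cell of its own, with a single code; every edge is local because both ends are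
  -- alone.
  Reach-singletons : 3 ≤ w → 0 < N → {A : Set} {Q : V → A} → (∀ x y → Q x ≡ Q y → x ≡ y) → Reach Q
  Reach-singletons 3≤w (s≤s {n = k} _) Q-inj = k , id ,
    start refl (λ x y e → e) (λ x → x , refl)
      (stretch-≤ cells id (λ x y e → e) (λ x y e → e) (λ x → x , refl) 3≤w) ,
    λ x y → mk⇔ (cong _) (Q-inj x y)
    where
    cells : Cells 1 id id
    cells = record
      { cell = λ x → toℕ (σ ⟨$⟩ʳ x)
      ; code = λ _ → zero
      ; mono = λ _ _ h → h
      ; within = λ _ _ → cong _
      ; coded = λ x y e _ → Injection.injective (↔⇒↣ σ) (toℕ-injective e)
      ; local = λ x y _ → inj₂ ((λ _ e → e) , λ _ e → e)
      }

  Reach-constant⇒Stw : {A : Set} {Q : V → A} → (∀ x y → Q x ≡ Q y) → Reach Q → StwOrdAtMost H σ w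
  Reach-constant⇒Stw const (zero , c , ms , _) = toStwOrdAtMost ms
  Reach-constant⇒Stw const (suc k , c , ms , eqv)
    with Merges⇒onto ms zero | Merges⇒onto ms (suc zero)
  ... | x , cx≡0 | y , cy≡1
    with trans (sym cx≡0) (trans (Equivalence.from (eqv x y) (const x y)) cy≡1)
  ...   | ()

-- Dyadic cells: `halve r x` is the floor of x divided by 2^r.

halve : ℕ → ℕ → ℕ
halve zero x = x
halve (suc r) x = ⌊ halve r x /2⌋

halve-+ : ∀ a b x → halve (a + b) x ≡ halve a (halve b x)
halve-+ zero b x = refl
halve-+ (suc a) b x = cong ⌊_/2⌋ (halve-+ a b x)

halve-mono : ∀ r {x y} → x ≤ y → halve r x ≤ halve r y
halve-mono zero h = h
halve-mono (suc r) h = ⌊n/2⌋-mono (halve-mono r h)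

halve-Close : ∀ r {x y} → Close x y → Close (halve r x) (halve r y)
halve-Close zero cl = cl
halve-Close (suc r) cl with halve-Close r cl
... | h , h′ = ⌊n/2⌋-mono (m≤n⇒m≤1+n h) , ⌊n/2⌋-mono (m≤n⇒m≤1+n h′)

halve-2^ : ∀ r x → halve r (x * 2 ^ r) ≡ x
halve-2^ zero x = *-identityʳ x
halve-2^ (suc r) x = begin
  ⌊ halve r (x * (2 * 2 ^ r)) /2⌋ ≡⟨ cong (⌊_/2⌋ ∘ halve r) (*-assoc x 2 (2 ^ r)) ⟨
  ⌊ halve r (x * 2 * 2 ^ r) /2⌋   ≡⟨ cong ⌊_/2⌋ (halve-2^ r (x * 2)) ⟩
  ⌊ x * 2 /2⌋                     ≡⟨ half x ⟩
  x                               ∎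
  where
  open ≡-Reasoning
  half : ∀ x → ⌊ x * 2 /2⌋ ≡ x
  half zero = refl
  half (suc x) = cong suc (half x)

halve-odd : ∀ r q → halve (suc r) (suc (2 * q) * 2 ^ r) ≡ q
halve-odd r q = trans (cong ⌊_/2⌋ (halve-2^ r (suc (2 * q)))) (half q)
  where
  half : ∀ q → ⌊ suc (2 * q) /2⌋ ≡ q
  half q = trans (cong (λ z → ⌊ suc (q + z) /2⌋) (+-identityʳ q)) (sym (n≡⌈n+n/2⌉ q))

-- Each halving lowers a positive number by at least one. This crude bound suffices to see that
-- `halve r x` vanishes once `x ≤ r`.
halve≤∸ : ∀ r x → halve r x ≤ x ∸ r
halve≤∸ zero x = ≤-refl
halve≤∸ (suc r) x = ≤-trans (half (halve r x))
  (≤-trans (pred-mono-≤ (halve≤∸ r x)) (≤-reflexive (pred[m∸n]≡m∸[1+n] x r)))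
  where
  half : ∀ y → ⌊ y /2⌋ ≤ pred y
  half zero = z≤n
  half (suc y) = ≤-pred (⌊n/2⌋<n y)

parity : ℕ → Fin 2
parity 0 = 0F
parity 1 = 1F
parity (suc (suc x)) = parity x

-- Parity tells apart the two halves of a cell; `code` uses it to recover a cell from the one twice
-- as long.
half-parity-injective : ∀ x y → ⌊ x /2⌋ ≡ ⌊ y /2⌋ → parity x ≡ parity y → x ≡ y
half-parity-injective 0 0 _ _ = refl
half-parity-injective 1 1 _ _ = refl
half-parity-injective (suc (suc x)) (suc (suc y)) e e′ =
  cong (2 +_) (half-parity-injective x y (suc-injective e) e′)
half-parity-injective 0 1 _ ()
half-parity-injective 1 0 _ ()

*-swap-2 : ∀ a b → a * (2 * b) ≡ 2 * (a * b)
*-swap-2 a b = trans (sym (*-assoc a 2 b)) (trans (cong (_* b) (*-comm a 2)) (*-assoc 2 a b))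

-- Uniqueness of the 2-adic valuation and the odd part. It keeps paths of different levels at
-- different positions.
odd*2^-injective : ∀ r r′ q q′ → suc (2 * q) * 2 ^ r ≡ suc (2 * q′) * 2 ^ r′ → r ≡ r′ × q ≡ q′
odd*2^-injective zero zero q q′ e = refl , *-cancelˡ-≡ q q′ 2
  (suc-injective (trans (sym (*-identityʳ _)) (trans e (*-identityʳ _))))
odd*2^-injective zero (suc r′) q q′ e = contradiction
  (trans (sym (*-swap-2 (suc (2 * q′)) (2 ^ r′))) (trans (sym e) (*-identityʳ _)))
  (even≢odd (suc (2 * q′) * 2 ^ r′) q)
odd*2^-injective (suc r) zero q q′ e with odd*2^-injective zero (suc r) q′ q (sym e)
... | () , _
odd*2^-injective (suc r) (suc r′) q q′ e
  with odd*2^-injective r r′ q q′ (*-cancelˡ-≡ _ _ 2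
    (trans (sym (*-swap-2 (suc (2 * q)) (2 ^ r))) (trans e (*-swap-2 (suc (2 * q′)) (2 ^ r′)))))
... | refl , q≡q′ = refl , q≡q′

-- Numbering the edges by prefix sums.

offset : (f : Fin n → ℕ) → Fin n → ℕ
offset f zero = 0
offset f (suc i) = f zero + offset (f ∘ suc) i

-- With remainders `r < f i`, the values `offset f i + r` number the pairs (i, r) lexicographically,
-- starting at 0.
offset-< : (f : Fin n → ℕ) (i : Fin n) {r : ℕ} → r < f i → offset f i + r < sumFin f
offset-< f zero h = ≤-trans h (m≤m+n _ _)
offset-< f (suc i) {r} h = ≤-trans
  (≤-reflexive (cong suc (+-assoc (f zero) _ r)))
  (+-monoʳ-< (f zero) (offset-< (f ∘ suc) i h))

offset-injective : (f : Fin n → ℕ) (i j : Fin n) {r r′ : ℕ} → r < f i → r′ < f j →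
  offset f i + r ≡ offset f j + r′ → i ≡ j × r ≡ r′
offset-injective f zero zero h h′ e = refl , e
offset-injective f zero (suc j) h h′ refl = contradiction h
  (≤⇒≯ (≤-trans (m≤m+n (f zero) _) (m≤m+n _ _)))
offset-injective f (suc i) zero h h′ refl = contradiction h′
  (≤⇒≯ (≤-trans (m≤m+n (f zero) _) (m≤m+n _ _)))
offset-injective f (suc i) (suc j) {r} {r′} h h′ e
  with offset-injective (f ∘ suc) i j h h′ (+-cancelˡ-≡ (f zero) _ _
    (trans (sym (+-assoc (f zero) _ r)) (trans e (+-assoc (f zero) _ r′))))
... | refl , r≡r′ = refl , r≡r′

module _ (G : Graph) where
  private
    isEdge : Fin (size G) → Fin (size G) → Bool
    isEdge u v = ⌊ u F.<? v ⌋ ∧ adj G u v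

    indicator : Fin (size G) → Fin (size G) → ℕ
    indicator u v = if isEdge u v then 1 else 0

    0<indicator : (e : Edge G) → 0 < indicator (src e) (tgt e)
    0<indicator e with isEdge (src e) (tgt e)
      | Equivalence.from (T-∧ {⌊ src e F.<? tgt e ⌋}) (fromWitness (lt e) , isAdj e)
    ... | true | _ = z<s

    row : (e : Edge G) → offset (indicator (src e)) (tgt e) + 0 < countFin (isEdge (src e))
    row e = offset-< (indicator (src e)) (tgt e) (0<indicator e)

  -- Two nested prefix-sum numberings, by `src` and then by `tgt`. The inner block has size one, so
  -- its only remainder is 0.
  edgeIndex : Edge G → ℕ
  edgeIndex e = offset (λ u → countFin (isEdge u)) (src e) + (offset (indicator (src e)) (tgt e) + 0)

  edgeIndex<numEdges : ∀ e → edgeIndex e < numEdges G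
  edgeIndex<numEdges e = offset-< (λ u → countFin (isEdge u)) (src e) (row e)

  edgeIndex-injective : ∀ e e′ → edgeIndex e ≡ edgeIndex e′ → e ≡ e′
  edgeIndex-injective e e′ eq
    with offset-injective (λ u → countFin (isEdge u)) (src e) (src e′) (row e) (row e′) eq
  edgeIndex-injective e@(edge u v u<v a) e′@(edge u v′ u<v′ a′) _ | refl , eq
    with offset-injective (indicator u) v v′ (0<indicator e) (0<indicator e′) eq
  ... | refl , _ with <-irrelevant u<v u<v′ | T-irrelevant a a′
  ...   | refl | refl = refl

-- Lexicographic comparison through two-digit numerals in base `T`, and labels of parts.

lex-≤ : ∀ {T p p′ s s′} → s < T → s′ < T → p * T + s ≤ p′ * T + s′ → p < p′ ⊎ (p ≡ p′ × s ≤ s′)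
lex-≤ {T} {p} {p′} {s} {s′} s<T s′<T h with <-cmp p p′
... | tri< p<p′ _ _ = inj₁ p<p′
... | tri≈ _ refl _ = inj₂ (refl , +-cancelˡ-≤ (p * T) _ _ h)
... | tri> _ _ p′<p = contradiction h (<⇒≱ (begin-strict
  p′ * T + s′ <⟨ +-monoʳ-< (p′ * T) s′<T ⟩
  p′ * T + T  ≡⟨ +-comm (p′ * T) T ⟩
  suc p′ * T  ≤⟨ *-monoˡ-≤ T p′<p ⟩
  p * T       ≤⟨ m≤m+n _ _ ⟩
  p * T + s   ∎))
  where open ≤-Reasoning

≤-lex : ∀ {T p p′ s s′} → s < T → p < p′ ⊎ (p ≡ p′ × s ≤ s′) → p * T + s ≤ p′ * T + s′
≤-lex {T} {p} {p′} {s} {s′} s<T (inj₁ p<p′) = begin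
  p * T + s   ≤⟨ +-monoʳ-≤ (p * T) (<⇒≤ s<T) ⟩
  p * T + T   ≡⟨ +-comm (p * T) T ⟩
  suc p * T   ≤⟨ *-monoˡ-≤ T p<p′ ⟩
  p′ * T      ≤⟨ m≤m+n _ _ ⟩
  p′ * T + s′ ∎
  where open ≤-Reasoning
≤-lex {T} {p} s<T (inj₂ (refl , s≤s′)) = +-monoʳ-≤ (p * T) s≤s′

lex-injective : ∀ {T p p′ s s′} → s < T → s′ < T → p * T + s ≡ p′ * T + s′ → p ≡ p′ × s ≡ s′
lex-injective {T} {p} {p′} s<T s′<T e
  with lex-≤ {T} {p} {p′} s<T s′<T (≤-reflexive e)
     | lex-≤ {T} {p′} {p} s′<T s<T (≤-reflexive (sym e))
... | inj₂ (refl , h) | inj₂ (_ , h′) = refl , ≤-antisym h h′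
... | inj₁ p<p′ | inj₁ p′<p = contradiction p′<p (<⇒≯ p<p′)
... | inj₁ p<p′ | inj₂ (refl , _) = contradiction p<p′ (<-irrefl refl)
... | inj₂ (refl , _) | inj₁ p′<p = contradiction p′<p (<-irrefl refl)

0<2^ : ∀ r → 0 < 2 ^ r
0<2^ r = m^n>0 2 r

-- A `run` is named by its position, a `bundle` by the index of its cell.
data Label (V : Set) : Set where
  single : V → Label V
  run    : ℕ → Label V
  bundle : ℕ → Label V

single-injective : ∀ {V : Set} {x y : V} → single x ≡ single y → x ≡ y
single-injective refl = refl

run-injective : ∀ {V : Set} {p q} → run {V} p ≡ run q → p ≡ q
run-injective refl = refl

bundle-injective : ∀ {V : Set} {p q} → bundle {V} p ≡ bundle q → p ≡ q
bundle-injective refl = refl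

module _ {V : Set} (_≟ⱽ_ : ∀ (x y : V) → Dec (x ≡ y)) where
  label-≟ : (a b : Label V) → Dec (a ≡ b)
  label-≟ (single x) (single y) = map′ (cong single) (λ { refl → refl }) (x ≟ⱽ y)
  label-≟ (run p) (run q) = map′ (cong run) (λ { refl → refl }) (p ℕ.≟ q)
  label-≟ (bundle p) (bundle q) = map′ (cong bundle) (λ { refl → refl }) (p ℕ.≟ q)
  label-≟ (single _) (run _) = no λ ()
  label-≟ (single _) (bundle _) = no λ ()
  label-≟ (run _) (single _) = no λ ()
  label-≟ (run _) (bundle _) = no λ ()
  label-≟ (bundle _) (single _) = no λ ()
  label-≟ (bundle _) (run _) = no λ ()

-- Positions, levels and runs of the vertices of the subdivision.

module Layout (G : Graph) (ℓ : Edge G → ℕ) (m : ℕ)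
  (lev : Edge G → ℕ) (lev<m : ∀ e → lev e < m)
  (lev-injective : ∀ e e′ → lev e ≡ lev e′ → e ≡ e′)
  (long : ∀ e → size G * 2 ^ m ≤ ℓ e) where

  private
    W = SubVert G ℓ

  -- The unit is a cell of length 2^(lev e + 1). Consecutive branch vertices, 2^m apart, are
  -- `scale e` units apart, so `first e` and `last e` are the cells of the two ends.
  scale first last gap : Edge G → ℕ
  scale e = 2 ^ (m ∸ suc (lev e))
  first e = toℕ (src e) * scale e
  last e = toℕ (tgt e) * scale e
  gap e = last e ∸ first e

  -- The index of the cell of length 2 ^ suc (lev e) containing the s-th vertex of the path of e:
  -- inner vertices lie in the middle of that cell, branch vertices at its left end.
  track : Edge G → ℕ → ℕ
  track e s = (first e + s) ⊓ last e

  pos : W → ℕ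
  pos (inj₁ v) = toℕ v * 2 ^ m
  pos (inj₂ (e , t)) = suc (2 * track e (suc (toℕ t))) * 2 ^ lev e

  level : W → ℕ
  level (inj₁ _) = m
  level (inj₂ (e , _)) = lev e

  rank : W → ℕ
  rank (inj₁ _) = 0
  rank (inj₂ (_ , t)) = suc (toℕ t)

  -- Both bounds are strict: the vertex that arrives and the last inner vertex share the position of
  -- the run but stay outside. Hence both path neighbours of a run vertex lie at its position.
  InRun : W → Set
  InRun (inj₁ _) = ⊥
  InRun (inj₂ (e , t)) = gap e < suc (toℕ t) × suc (toℕ t) < ℓ e

  inRun? : ∀ w → Dec (InRun w)
  inRun? (inj₁ _) = no id
  inRun? (inj₂ (e , t)) = (gap e <? suc (toℕ t)) ×-dec (suc (toℕ t) <? ℓ e)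

  first<last : ∀ e → first e < last e
  first<last e = *-monoˡ-< (scale e) {{>-nonZero (0<2^ (m ∸ suc (lev e)))}} (lt e)

  0<gap : ∀ e → 0 < gap e
  0<gap e = m<n⇒0<n∸m (first<last e)

  first+gap : ∀ e → first e + gap e ≡ last e
  first+gap e = m+[n∸m]≡n (<⇒≤ (first<last e))

  -- Here the length of the subdivided edges enters: the walk arrives before its inner vertices are
  -- used up.
  gap<ℓ : ∀ e → gap e < ℓ e
  gap<ℓ e = begin-strict
    gap e             ≤⟨ m∸n≤m (last e) (first e) ⟩
    last e            ≤⟨ *-monoʳ-≤ (toℕ (tgt e)) (^-monoʳ-≤ 2 (m∸n≤m m (suc (lev e)))) ⟩
    toℕ (tgt e) * 2 ^ m <⟨ *-monoˡ-< (2 ^ m) {{>-nonZero (0<2^ m)}} (toℕ<n (tgt e)) ⟩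
    size G * 2 ^ m    ≤⟨ long e ⟩
    ℓ e               ∎
    where open ≤-Reasoning

  scale*2^ : ∀ e → scale e * 2 ^ suc (lev e) ≡ 2 ^ m
  scale*2^ e = trans (sym (^-distribˡ-+-* 2 (m ∸ suc (lev e)) (suc (lev e))))
    (cong (2 ^_) (m∸n+n≡m (lev<m e)))

  track-gap : ∀ e {s} → gap e ≤ s → track e s ≡ last e
  track-gap e {s} h = m≥n⇒m⊓n≡n (≤-trans (≤-reflexive (sym (first+gap e))) (+-monoʳ-≤ (first e) h))

  track-≤gap : ∀ e {s} → s ≤ gap e → track e s ≡ first e + s
  track-≤gap e {s} h = m≤n⇒m⊓n≡m (≤-trans (+-monoʳ-≤ (first e) h) (≤-reflexive (first+gap e)))

  track-Close : ∀ e s → Close (track e s) (track e (suc s))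
  track-Close e s =
    ≤-trans (⊓-monoˡ-≤ (last e) (+-monoʳ-≤ (first e) (n≤1+n s))) (n≤1+n _) ,
    ≤-trans (⊓-mono-≤ (≤-reflexive (+-suc (first e) s)) (n≤1+n (last e))) ≤-refl

  pathVert-inner : ∀ e {s} (s<ℓ : s < ℓ e) → pathVert G ℓ e (suc s) ≡ inj₂ (e , fromℕ< s<ℓ)
  pathVert-inner e {s} s<ℓ with s <? ℓ e
  ... | yes _ = refl
  ... | no s≮ℓ = contradiction s<ℓ s≮ℓ

  halve-branch : ∀ e v → halve (suc (lev e)) (toℕ v * 2 ^ m) ≡ toℕ {size G} v * scale e
  halve-branch e v = begin
    halve (suc ρ) (toℕ v * 2 ^ m)                   ≡⟨ cong (λ z → halve (suc ρ) (toℕ v * z)) (scale*2^ e) ⟨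
    halve (suc ρ) (toℕ v * (scale e * 2 ^ suc ρ))   ≡⟨ cong (halve (suc ρ)) (*-assoc (toℕ v) (scale e) _) ⟨
    halve (suc ρ) (toℕ v * scale e * 2 ^ suc ρ)     ≡⟨ halve-2^ (suc ρ) _ ⟩
    toℕ v * scale e                                 ∎
    where
    open ≡-Reasoning
    ρ = lev e

  -- At this resolution the entire path, ends included, follows the track; at the right end this is
  -- because the walk has arrived, by `gap<ℓ`.
  halve-pos-pathVert : ∀ e s → halve (suc (lev e)) (pos (pathVert G ℓ e s)) ≡ track e s
  halve-pos-pathVert e zero = trans (halve-branch e (src e))
    (trans (sym (+-identityʳ _)) (sym (track-≤gap e z≤n)))
  halve-pos-pathVert e (suc s) with s <? ℓ e
  ... | yes s<ℓ = trans (halve-odd (lev e) _) (cong (track e ∘ suc) (toℕ-fromℕ< s<ℓ))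
  ... | no s≮ℓ = trans (halve-branch e (tgt e))
    (sym (track-gap e (≤-trans (<⇒≤ (gap<ℓ e)) (m≤n⇒m≤1+n (≮⇒≥ s≮ℓ)))))

  lev≤level-pathVert : ∀ e s → lev e ≤ level (pathVert G ℓ e s)
  lev≤level-pathVert e zero = <⇒≤ (lev<m e)
  lev≤level-pathVert e (suc s) with s <? ℓ e
  ... | yes _ = ≤-refl
  ... | no _ = <⇒≤ (lev<m e)

  inner-neighbours : ∀ e {s} → gap e ≤ suc s → suc s < ℓ e →
    pos (pathVert G ℓ e (suc s)) ≡ pos (pathVert G ℓ e (2 + s)) ×
    rank (pathVert G ℓ e (2 + s)) ≡ suc (rank (pathVert G ℓ e (suc s)))
  inner-neighbours e {s} gap≤ s+1<ℓ
    rewrite pathVert-inner e (<⇒≤ s+1<ℓ) | pathVert-inner e s+1<ℓ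
          | toℕ-fromℕ< (<⇒≤ s+1<ℓ) | toℕ-fromℕ< s+1<ℓ
          | track-gap e gap≤ | track-gap e (m≤n⇒m≤1+n gap≤) = refl , refl

  InRun-pathVert⁻ : ∀ e s → InRun (pathVert G ℓ e (suc s)) → gap e < suc s × suc s < ℓ e
  InRun-pathVert⁻ e s h with s <? ℓ e
  ... | yes s<ℓ = subst (λ z → gap e < suc z × suc z < ℓ e) (toℕ-fromℕ< s<ℓ) h

  run-neighbours : ∀ e s → InRun (pathVert G ℓ e s) ⊎ InRun (pathVert G ℓ e (suc s)) →
    pos (pathVert G ℓ e s) ≡ pos (pathVert G ℓ e (suc s)) ×
    rank (pathVert G ℓ e (suc s)) ≡ suc (rank (pathVert G ℓ e s))
  run-neighbours e zero (inj₂ h) =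
    contradiction (≤-pred (proj₁ (InRun-pathVert⁻ e 0 h))) (<⇒≱ (0<gap e))
  run-neighbours e (suc s) (inj₁ h) with InRun-pathVert⁻ e s h
  ... | gap< , <ℓ = inner-neighbours e (<⇒≤ gap<) <ℓ
  run-neighbours e (suc s) (inj₂ h) with InRun-pathVert⁻ e (suc s) h
  ... | gap< , <ℓ = inner-neighbours e (≤-pred gap<) (<⇒≤ <ℓ)

  -- The exponent of two in the position is the level, and the level determines the edge.
  pos-injective : ∀ e t e′ t′ → pos (inj₂ (e , t)) ≡ pos (inj₂ (e′ , t′)) →
    e ≡ e′ × track e (suc (toℕ t)) ≡ track e′ (suc (toℕ t′))
  pos-injective e t e′ t′ eq with odd*2^-injective (lev e) (lev e′) _ _ eq
  ... | lev≡ , track≡ = lev-injective e e′ lev≡ , track≡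

  InRun⇒level : ∀ w w′ → InRun w → InRun w′ → pos w ≡ pos w′ → level w ≡ level w′
  InRun⇒level (inj₂ (e , t)) (inj₂ (e′ , t′)) _ _ eq = cong lev (proj₁ (pos-injective e t e′ t′ eq))

  InRun⇒≡ : ∀ w w′ → InRun w → InRun w′ → pos w ≡ pos w′ → rank w ≡ rank w′ → w ≡ w′
  InRun⇒≡ (inj₂ (e , t)) (inj₂ (e′ , t′)) _ _ eq eq′ with pos-injective e t e′ t′ eq
  ... | refl , _ with toℕ-injective (suc-injective eq′)
  ...   | refl = refl

  -- A position of level at least `r` is a multiple of 2^r, so multiplying its cell index by 2^r
  -- gives it back.
  halve-pos-injective : ∀ r w w′ → r ≤ level w → r ≤ level w′ →
    halve r (pos w) ≡ halve r (pos w′) → pos w ≡ pos w′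
  halve-pos-injective r w w′ r≤ r≤′ eq =
    trans (sym (restore w r≤)) (trans (cong (_* 2 ^ r) eq) (restore w′ r≤′))
    where
    restore* : ∀ x {k} → r ≤ k → halve r (x * 2 ^ k) * 2 ^ r ≡ x * 2 ^ k
    restore* x {k} r≤k = begin
      halve r (x * 2 ^ k) * 2 ^ r                 ≡⟨ cong (λ z → halve r z * 2 ^ r) split ⟩
      halve r (x * 2 ^ (k ∸ r) * 2 ^ r) * 2 ^ r   ≡⟨ cong (_* 2 ^ r) (halve-2^ r (x * 2 ^ (k ∸ r))) ⟩
      x * 2 ^ (k ∸ r) * 2 ^ r                     ≡⟨ split ⟨
      x * 2 ^ k                                   ∎
      where
      open ≡-Reasoning
      split : x * 2 ^ k ≡ x * 2 ^ (k ∸ r) * 2 ^ r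
      split = begin
        x * 2 ^ k                     ≡⟨ cong (λ z → x * 2 ^ z) (m∸n+n≡m r≤k) ⟨
        x * 2 ^ (k ∸ r + r)           ≡⟨ cong (x *_) (^-distribˡ-+-* 2 (k ∸ r) r) ⟩
        x * (2 ^ (k ∸ r) * 2 ^ r)     ≡⟨ *-assoc x _ _ ⟨
        x * 2 ^ (k ∸ r) * 2 ^ r       ∎
    restore : ∀ w → r ≤ level w → halve r (pos w) * 2 ^ r ≡ pos w
    restore (inj₁ v) = restore* (toℕ v)
    restore (inj₂ (e , t)) = restore* (suc (2 * track e (suc (toℕ t))))

  -- Branch vertex, walking vertex, run vertex, last inner vertex. At one position each shape other
  -- than the run occurs at most once, since the track is injective up to arrival.
  shape : W → Fin 4
  shape (inj₁ _) = 0F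
  shape (inj₂ (e , t)) with suc (toℕ t) ≤? gap e | suc (toℕ t) <? ℓ e
  ... | yes _ | _     = 1F
  ... | no _  | yes _ = 2F
  ... | no _  | no _  = 3F

  pos-shape-injective : ∀ w w′ → pos w ≡ pos w′ → shape w ≡ shape w′ → w ≡ w′ ⊎ (InRun w × InRun w′)
  pos-shape-injective (inj₁ v) (inj₁ v′) eq _ = inj₁ (cong inj₁ (toℕ-injective
    (*-cancelʳ-≡ _ _ (2 ^ m) {{>-nonZero (0<2^ m)}} eq)))
  pos-shape-injective (inj₁ v) (inj₂ (e , t)) _ h with suc (toℕ t) ≤? gap e | suc (toℕ t) <? ℓ e
  pos-shape-injective (inj₁ v) (inj₂ (e , t)) _ () | yes _ | _
  pos-shape-injective (inj₁ v) (inj₂ (e , t)) _ () | no _ | yes _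
  pos-shape-injective (inj₁ v) (inj₂ (e , t)) _ () | no _ | no _
  pos-shape-injective (inj₂ (e , t)) (inj₁ v) _ h with suc (toℕ t) ≤? gap e | suc (toℕ t) <? ℓ e
  pos-shape-injective (inj₂ (e , t)) (inj₁ v) _ () | yes _ | _
  pos-shape-injective (inj₂ (e , t)) (inj₁ v) _ () | no _ | yes _
  pos-shape-injective (inj₂ (e , t)) (inj₁ v) _ () | no _ | no _
  pos-shape-injective (inj₂ (e , t)) (inj₂ (e′ , t′)) eq h with pos-injective e t e′ t′ eq
  ... | refl , track≡ with suc (toℕ t) ≤? gap e | suc (toℕ t) <? ℓ e
                         | suc (toℕ t′) ≤? gap e | suc (toℕ t′) <? ℓ e
  ...   | yes t≤ | _ | yes t′≤ | _ = inj₁ (cong (λ t → inj₂ (e , t)) (toℕ-injective (suc-injective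
    (+-cancelˡ-≡ (first e) _ _ (trans (sym (track-≤gap e t≤)) (trans track≡ (track-≤gap e t′≤)))))))
  ...   | no t≰ | yes t< | no t′≰ | yes t′< = inj₂ ((≰⇒> t≰ , t<) , (≰⇒> t′≰ , t′<))
  ...   | no _ | no t≮ | no _ | no t′≮ = inj₁ (cong (λ t → inj₂ (e , t)) (toℕ-injective (suc-injective
    (trans (≤-antisym (toℕ<n t) (≮⇒≥ t≮)) (≤-antisym (≮⇒≥ t′≮) (toℕ<n t′))))))
  pos-shape-injective (inj₂ (e , t)) (inj₂ (e′ , t′)) eq () | refl , _ | yes _ | _ | no _ | yes _
  pos-shape-injective (inj₂ (e , t)) (inj₂ (e′ , t′)) eq () | refl , _ | yes _ | _ | no _ | no _
  pos-shape-injective (inj₂ (e , t)) (inj₂ (e′ , t′)) eq () | refl , _ | no _ | yes _ | yes _ | _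
  pos-shape-injective (inj₂ (e , t)) (inj₂ (e′ , t′)) eq () | refl , _ | no _ | no _ | yes _ | _
  pos-shape-injective (inj₂ (e , t)) (inj₂ (e′ , t′)) eq () | refl , _ | no _ | yes _ | no _ | no _
  pos-shape-injective (inj₂ (e , t)) (inj₂ (e′ , t′)) eq () | refl , _ | no _ | no _ | no _ | yes _

  Settled : ℕ → W → Set
  Settled r w = r ≤ level w × ¬ InRun w

  -- The source of locality: the ends are close in cells of length 2^r, or consecutive at one
  -- position, or both still singletons.
  edge-cases : ∀ r e s →
    let x = pathVert G ℓ e s; y = pathVert G ℓ e (suc s) in
    lev e < r ⊎ (pos x ≡ pos y × rank y ≡ suc (rank x)) ⊎ (Settled r x × Settled r y)
  edge-cases r e s with lev e <? r | inRun? (pathVert G ℓ e s) | inRun? (pathVert G ℓ e (suc s))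
  ... | yes h | _ | _ = inj₁ h
  ... | no _ | yes h | _ = inj₂ (inj₁ (run-neighbours e s (inj₁ h)))
  ... | no _ | no _ | yes h = inj₂ (inj₁ (run-neighbours e s (inj₂ h)))
  ... | no h | no ¬x | no ¬y = inj₂ (inj₂
    ( (≤-trans (≮⇒≥ h) (lev≤level-pathVert e s) , ¬x)
    , (≤-trans (≮⇒≥ h) (lev≤level-pathVert e (suc s)) , ¬y)))

  -- Above its own level the path is seen through further halvings of the track, which moves by at
  -- most one and whose closeness halving preserves.
  halve-pathVert-Close : ∀ r e s → lev e < r →
    Close (halve r (pos (pathVert G ℓ e s))) (halve r (pos (pathVert G ℓ e (suc s))))
  halve-pathVert-Close r e s lev<r = subst (λ r → Close (halve r (pos (pathVert G ℓ e s)))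
      (halve r (pos (pathVert G ℓ e (suc s))))) (m∸n+n≡m lev<r)
    (subst₂ Close (sym (unfold s)) (sym (unfold (suc s)))
      (halve-Close d (track-Close e s)))
    where
    d = r ∸ suc (lev e)
    unfold : ∀ s → halve (d + suc (lev e)) (pos (pathVert G ℓ e s)) ≡ halve d (track e s)
    unfold s = trans (halve-+ d _ _) (cong (halve d) (halve-pos-pathVert e s))

  -- The partitions, as labellings.

  module Labelling {N : ℕ} (to : Fin N → W) where

    -- One family serves both stages: `i` bounds the ranks merged into the runs while `r` is 0, then
    -- `r` grows with `i` at the maximal rank. Bundling takes precedence, so bundles absorb runs.
    label : ℕ → ℕ → Fin N → Label (Fin N)
    label i r x with level (to x) <? r | inRun? (to x) ×-dec (rank (to x) ≤? i)
    ... | yes _ | _     = bundle (halve r (pos (to x)))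
    ... | no _  | yes _ = run (pos (to x))
    ... | no _  | no _  = single x

    data View (i r : ℕ) (x : Fin N) : Label (Fin N) → Set where
      bundled : level (to x) < r → View i r x (bundle (halve r (pos (to x))))
      running : r ≤ level (to x) → InRun (to x) → rank (to x) ≤ i → View i r x (run (pos (to x)))
      alone   : r ≤ level (to x) → (InRun (to x) → i < rank (to x)) → View i r x (single x)

    view : ∀ i r x → View i r x (label i r x)
    view i r x with level (to x) <? r | inRun? (to x) ×-dec (rank (to x) ≤? i)
    ... | yes h | _           = bundled h
    ... | no h  | yes (p , q) = running (≮⇒≥ h) p q
    ... | no h  | no ¬pq      = alone (≮⇒≥ h) (λ p → ≰⇒> (λ q → ¬pq (p , q)))

    label-bundle : ∀ i r x → level (to x) < r → label i r x ≡ bundle (halve r (pos (to x)))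
    label-bundle i r x h with label i r x | view i r x
    ... | _ | bundled _ = refl
    ... | _ | running r≤ _ _ = contradiction h (≤⇒≯ r≤)
    ... | _ | alone r≤ _ = contradiction h (≤⇒≯ r≤)

    label-run : ∀ i r x → r ≤ level (to x) → InRun (to x) → rank (to x) ≤ i →
      label i r x ≡ run (pos (to x))
    label-run i r x r≤ p q with label i r x | view i r x
    ... | _ | bundled h = contradiction h (≤⇒≯ r≤)
    ... | _ | running _ _ _ = refl
    ... | _ | alone _ h = contradiction (h p) (≤⇒≯ q)

    tag : Label (Fin N) → Fin 3
    tag (single _) = 0F
    tag (run _)    = 1F
    tag (bundle _) = 2F

    -- Equal tags leave three cases. Bundles are named by the cell; runs by the position, which the
    -- cell determines at level at least `r`; single vertices are fixed by position and shape,
    -- except unmerged run vertices, which need the rank.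
    label-≡ : ∀ i r x y → halve r (pos (to x)) ≡ halve r (pos (to y)) →
      tag (label i r x) ≡ tag (label i r y) → shape (to x) ≡ shape (to y) →
      (∀ {u v} → to u ≡ to v → u ≡ v) →
      (InRun (to x) → InRun (to y) → i < rank (to x) → i < rank (to y) → rank (to x) ≡ rank (to y)) →
      label i r x ≡ label i r y
    label-≡ i r x y half≡ tag≡ shape≡ to-injective rank≡
      with label i r x | view i r x | label i r y | view i r y
    ... | _ | bundled _ | _ | bundled _ = cong bundle half≡
    ... | _ | running r≤x _ _ | _ | running r≤y _ _ =
      cong run (halve-pos-injective r (to x) (to y) r≤x r≤y half≡)
    ... | _ | alone r≤x i<x | _ | alone r≤y i<y
      with halve-pos-injective r (to x) (to y) r≤x r≤y half≡
    ...   | pos≡ with pos-shape-injective (to x) (to y) pos≡ shape≡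
    ...     | inj₁ x≡y = cong single (to-injective x≡y)
    ...     | inj₂ (p , q) = cong single (to-injective
      (InRun⇒≡ (to x) (to y) p q pos≡ (rank≡ p q (i<x p) (i<y q))))

    settled⇒alone : ∀ i r x → Settled r (to x) → ∀ y → label i r y ≡ label i r x → y ≡ x
    settled⇒alone i r x (r≤ , ¬run) y e with label i r x | view i r x | label i r y | view i r y
    ... | _ | bundled h | _ | _ = contradiction h (≤⇒≯ r≤)
    ... | _ | running _ h _ | _ | _ = contradiction h ¬run
    settled⇒alone i r x (r≤ , ¬run) y refl | _ | alone _ _ | _ | alone _ _ = refl

-- Cells for the two stages and the resulting partition sequence.

Close-⊔ : ∀ a b c → Close a b → Close (a ⊔ c) (b ⊔ c)
Close-⊔ a b c (h , h′) =
  ⊔-lub (≤-trans h (s≤s (m≤m⊔n b c))) (m≤n⇒m≤1+n (m≤n⊔m b c)) ,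
  ⊔-lub (≤-trans h′ (s≤s (m≤m⊔n a c))) (m≤n⇒m≤1+n (m≤n⊔m a c))

Close-+ : ∀ a {b c} → Close b c → Close (a + b) (a + c)
Close-+ a (h , h′) =
  ≤-trans (+-monoʳ-≤ a h) (≤-reflexive (+-suc a _)) ,
  ≤-trans (+-monoʳ-≤ a h′) (≤-reflexive (+-suc a _))

module Subdivision (G : Graph) (ℓ : Edge G → ℕ) (m : ℕ)
  (lev : Edge G → ℕ) (lev<m : ∀ e → lev e < m)
  (lev-injective : ∀ e e′ → lev e ≡ lev e′ → e ≡ e′)
  (long : ∀ e → size G * 2 ^ m ≤ ℓ e)
  (H : Graph) (f : Fin (size H) ↔ SubVert G ℓ)
  (adj⇒SubAdj : ∀ x y → T (adj H x y) → SubAdj G ℓ (Inverse.to f x) (Inverse.to f y))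
  (w : ℕ) (72≤w : 72 ≤ w) where

  private
    V = Fin (size H)
    to = Inverse.to f

    to-injective : ∀ {x y} → to x ≡ to y → x ≡ y
    to-injective = Injection.injective (↔⇒↣ f)

  open Layout G ℓ m lev lev<m lev-injective long
  open Labelling to

  maxRank base : ℕ
  maxRank = maxFin (rank ∘ to)
  base = suc maxRank

  rank≤ : ∀ x → rank (to x) ≤ maxRank
  rank≤ = ≤-maxFin (rank ∘ to)

  -- Position is the leading digit and path index breaks ties; `base` exceeds every rank.
  sorting = sortBy λ x → pos (to x) * base + rank (to x)

  σ : Permutation′ (size H)
  σ = proj₁ sorting

  σ-lex : ∀ x y → toℕ (σ ⟨$⟩ʳ x) ≤ toℕ (σ ⟨$⟩ʳ y) →
    pos (to x) < pos (to y) ⊎ (pos (to x) ≡ pos (to y) × rank (to x) ≤ rank (to y))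
  σ-lex x y h = lex-≤ (s≤s (rank≤ x)) (s≤s (rank≤ y)) (proj₂ sorting x y h)

  open Contraction H σ w

  -- Three tags, four shapes and two parities give 24 codes, whence the stretch bound 3 * 24 = 72.
  code : ℕ → ℕ → V → Fin 24
  code i r x = combine (combine (tag (label i r x)) (shape (to x))) (parity (halve r (pos (to x))))

  code-≡ : ∀ i r x y → code i r x ≡ code i r y →
    tag (label i r x) ≡ tag (label i r y) × shape (to x) ≡ shape (to y) ×
    parity (halve r (pos (to x))) ≡ parity (halve r (pos (to y)))
  code-≡ i r x y e
    with combine-injective
           (combine (tag (label i r x)) (shape (to x))) (parity (halve r (pos (to x))))
           (combine (tag (label i r y)) (shape (to y))) (parity (halve r (pos (to y)))) e
  ... | e′ , parity≡
    with combine-injective (tag (label i r x)) (shape (to x)) (tag (label i r y)) (shape (to y)) e′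
  ...   | tag≡ , shape≡ = tag≡ , shape≡ , parity≡

  path-cases : (g : SubVert G ℓ → ℕ) (i r : ℕ) →
    (∀ e s → lev e < r → Close (g (pathVert G ℓ e s)) (g (pathVert G ℓ e (suc s)))) →
    (∀ u v → pos u ≡ pos v → rank v ≡ suc (rank u) → Close (g u) (g v)) →
    ∀ e s x y → to x ≡ pathVert G ℓ e s → to y ≡ pathVert G ℓ e (suc s) →
    Close (g (to x)) (g (to y)) ⊎ (Alone (label i r) x × Alone (label i r) y)
  path-cases g i r bundle-Close run-Close e s x y x≡ y≡ with edge-cases r e s
  ... | inj₁ lev<r =
    inj₁ (subst₂ (λ u v → Close (g u) (g v)) (sym x≡) (sym y≡) (bundle-Close e s lev<r))
  ... | inj₂ (inj₁ (pos≡ , rank≡)) =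
    inj₁ (subst₂ (λ u v → Close (g u) (g v)) (sym x≡) (sym y≡) (run-Close _ _ pos≡ rank≡))
  ... | inj₂ (inj₂ (sx , sy)) = inj₂
    ( settled⇒alone i r x (subst (Settled r) (sym x≡) sx)
    , settled⇒alone i r y (subst (Settled r) (sym y≡) sy))

  adj-cases : (g : SubVert G ℓ → ℕ) (i r : ℕ) →
    (∀ e s → lev e < r → Close (g (pathVert G ℓ e s)) (g (pathVert G ℓ e (suc s)))) →
    (∀ u v → pos u ≡ pos v → rank v ≡ suc (rank u) → Close (g u) (g v)) →
    ∀ x y → T (adj H x y) → Close (g (to x)) (g (to y)) ⊎ (Alone (label i r) x × Alone (label i r) y)
  adj-cases g i r bundle-Close run-Close x y axy with adj⇒SubAdj x y axy
  ... | e , s , _ , inj₁ (x≡ , y≡) = path-cases g i r bundle-Close run-Close e s x y x≡ y≡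
  ... | e , s , _ , inj₂ (y≡ , x≡) with path-cases g i r bundle-Close run-Close e s y x y≡ x≡
  ...   | inj₁ cl = inj₁ (Close-sym cl)
  ...   | inj₂ (ay , ax) = inj₂ (ax , ay)

  -- The maximum with suc i collapses to one cell the part of a run that has been merged so far.
  runCell : ℕ → SubVert G ℓ → ℕ
  runCell i u = pos u * base + (rank u ⊔ suc i)

  -- A position can hold arbitrarily many unmerged run vertices, so the cell must record the rank as
  -- well. Path order makes this local: the next run vertex to be merged is adjacent to what is
  -- already collapsed.
  runCells : ∀ i → i < maxRank → Cells 24 (label i 0) (label (suc i) 0)
  runCells i i<max = record
    { cell = runCell i ∘ to
    ; code = code i 0
    ; mono = λ x y h → ≤-lex {p = pos (to x)} {p′ = pos (to y)} (⊔<base x)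
        (Sum.map₂ (λ (p , q) → p , ⊔-monoˡ-≤ (suc i) q) (σ-lex x y h))
    ; within = within
    ; coded = coded
    ; local = adj-cases (runCell i) (suc i) 0 (λ _ _ ())
        λ u v pos≡ rank≡ → subst₂ (λ p s → Close (runCell i u) (p * base + (s ⊔ suc i))) pos≡ (sym rank≡)
          (Close-+ (pos u * base) (Close-⊔ (rank u) _ (suc i) (m≤n⇒m≤1+n (n≤1+n _) , ≤-refl)))
    }
    where
    ⊔<base : ∀ x → rank (to x) ⊔ suc i < base
    ⊔<base x = s≤s (⊔-lub (rank≤ x) i<max)

    within : ∀ x y → label (suc i) 0 x ≡ label (suc i) 0 y → runCell i (to x) ≡ runCell i (to y)
    within x y e with label (suc i) 0 x | view (suc i) 0 x | label (suc i) 0 y | view (suc i) 0 y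
    within x y e | _ | running _ _ rx | _ | running _ _ ry =
      cong₂ (λ p s → p * base + s) (run-injective e)
        (trans (m≤n⇒m⊔n≡n rx) (sym (m≤n⇒m⊔n≡n ry)))
    within x y refl | _ | alone _ _ | _ | alone _ _ = refl

    coded : ∀ x y → runCell i (to x) ≡ runCell i (to y) → code i 0 x ≡ code i 0 y →
      label i 0 x ≡ label i 0 y
    coded x y cell≡ c≡
      with lex-injective {p = pos (to x)} {pos (to y)} (⊔<base x) (⊔<base y) cell≡
         | code-≡ i 0 x y c≡
    ... | pos≡ , ⊔≡ | tag≡ , shape≡ , _ = label-≡ i 0 x y pos≡ tag≡ shape≡ to-injective
      -- An unmerged rank exceeds `i`, so the maximum with `suc i` leaves it unchanged.
      λ _ _ i<x i<y → trans (sym (m≥n⇒m⊔n≡m i<x)) (trans ⊔≡ (m≥n⇒m⊔n≡m i<y))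

  run-refines : ∀ i x y → label i 0 x ≡ label i 0 y → label (suc i) 0 x ≡ label (suc i) 0 y
  run-refines i x y e with label i 0 x | view i 0 x | label i 0 y | view i 0 y
  run-refines i x y e | _ | running _ px rx | _ | running _ py ry =
    trans (label-run (suc i) 0 x z≤n px (m≤n⇒m≤1+n rx))
      (trans e (sym (label-run (suc i) 0 y z≤n py (m≤n⇒m≤1+n ry))))
  run-refines i x y refl | _ | alone _ _ | _ | alone _ _ = refl

  -- The cells are those of the coarse partition, twice as long as those naming the fine bundles.
  bundleCells : ∀ r → Cells 24 (label maxRank r) (label maxRank (suc r))
  bundleCells r = record
    { cell = λ x → halve (suc r) (pos (to x))
    ; code = code maxRank r
    ; mono = λ x y h → halve-mono (suc r) ([ <⇒≤ , ≤-reflexive ∘ proj₁ ]′ (σ-lex x y h))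
    ; within = within
    ; coded = coded
    ; local = adj-cases (halve (suc r) ∘ pos) maxRank (suc r) (halve-pathVert-Close (suc r))
        λ u v pos≡ _ →
          subst (λ p → Close (halve (suc r) (pos u)) (halve (suc r) p)) pos≡ (n≤1+n _ , n≤1+n _)
    }
    where
    within : ∀ x y → label maxRank (suc r) x ≡ label maxRank (suc r) y →
      halve (suc r) (pos (to x)) ≡ halve (suc r) (pos (to y))
    within x y e with label maxRank (suc r) x | view maxRank (suc r) x
                    | label maxRank (suc r) y | view maxRank (suc r) y
    within x y e | _ | bundled _ | _ | bundled _ = bundle-injective e
    within x y e | _ | running _ _ _ | _ | running _ _ _ = cong (halve (suc r)) (run-injective e)
    within x y refl | _ | alone _ _ | _ | alone _ _ = refl

    coded : ∀ x y → halve (suc r) (pos (to x)) ≡ halve (suc r) (pos (to y)) →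
      code maxRank r x ≡ code maxRank r y → label maxRank r x ≡ label maxRank r y
    coded x y half≡ c≡ with code-≡ maxRank r x y c≡
    ... | tag≡ , shape≡ , parity≡ =
      label-≡ maxRank r x y (half-parity-injective _ _ half≡ parity≡) tag≡ shape≡ to-injective
        -- At the maximal rank no run vertex is left unmerged.
        λ _ _ max<x _ → contradiction (rank≤ x) (<⇒≱ max<x)

  bundle-refines : ∀ r x y → label maxRank r x ≡ label maxRank r y →
    label maxRank (suc r) x ≡ label maxRank (suc r) y
  bundle-refines r x y e with label maxRank r x | view maxRank r x
                            | label maxRank r y | view maxRank r y
  bundle-refines r x y e | _ | bundled hx | _ | bundled hy =
    trans (label-bundle maxRank (suc r) x (m≤n⇒m≤1+n hx))
      (trans (cong (bundle ∘ ⌊_/2⌋) (bundle-injective e))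
        (sym (label-bundle maxRank (suc r) y (m≤n⇒m≤1+n hy))))
  -- A run occupies one position, so its vertices share a level and enter a bundle together.
  bundle-refines r x y e | _ | running _ px rx | _ | running _ py ry
    with InRun⇒level (to x) (to y) px py (run-injective e) | <-≤-connex (level (to x)) (suc r)
  ... | level≡ | inj₁ h =
    trans (label-bundle maxRank (suc r) x h)
      (trans (cong (bundle ∘ halve (suc r)) (run-injective e))
        (sym (label-bundle maxRank (suc r) y (subst (_< suc r) level≡ h))))
  ... | level≡ | inj₂ h =
    trans (label-run maxRank (suc r) x h px rx)
      (trans e (sym (label-run maxRank (suc r) y (subst (suc r ≤_) level≡ h) py ry)))
  bundle-refines r x y refl | _ | alone _ _ | _ | alone _ _ = refl

  label-dec : ∀ i r x y → Dec (label i r x ≡ label i r y)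
  label-dec i r x y = label-≟ _≟_ (label i r x) (label i r y)

  singletons : ∀ x y → label 0 0 x ≡ label 0 0 y → x ≡ y
  singletons x y e with label 0 0 x | view 0 0 x | label 0 0 y | view 0 0 y
  singletons x y e | _ | running _ px rx | _ | running _ _ _ = ⊥-elim (0<rank (to x) px rx)
    where
    0<rank : ∀ u → InRun u → ¬ (rank u ≤ 0)
    0<rank (inj₂ _) _ ()
  singletons x y e | _ | alone _ _ | _ | alone _ _ = single-injective e

  Reach-runs : 0 < size H → ∀ i → i ≤ maxRank → Reach (label i 0)
  Reach-runs 0<N zero _ = Reach-singletons (≤-trans (m≤m+n 3 69) 72≤w) 0<N singletons
  Reach-runs 0<N (suc i) i<max = Reach-coarsen (runCells i i<max) 72≤w (label-dec (suc i) 0)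
    (run-refines i) (Reach-runs 0<N i (<⇒≤ i<max))

  Reach-bundles : 0 < size H → ∀ r → Reach (label maxRank r)
  Reach-bundles 0<N zero = Reach-runs 0<N maxRank ≤-refl
  Reach-bundles 0<N (suc r) = Reach-coarsen (bundleCells r) 72≤w (label-dec maxRank (suc r))
    (bundle-refines r) (Reach-bundles 0<N r)

  -- Above every level, so all vertices are bundled, and at least every position, so the only bundle
  -- is cell 0.
  depth : ℕ
  depth = suc (maxFin (level ∘ to)) + maxFin (pos ∘ to)

  label-depth : ∀ x → label maxRank depth x ≡ bundle 0
  label-depth x = trans
    (label-bundle maxRank depth x (s≤s (≤-trans (≤-maxFin (level ∘ to) x) (m≤m+n _ _))))
    (cong bundle (n≤0⇒n≡0 (≤-trans (halve≤∸ depth (pos (to x)))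
      (≤-reflexive (m≤n⇒m∸n≡0 (≤-trans (≤-maxFin (pos ∘ to) x)
        (m≤n+m _ (suc (maxFin (level ∘ to))))))))))

  stw : 0 < size H → StwAtMost H w
  stw 0<N = σ , Reach-constant⇒Stw (λ x y → trans (label-depth x) (sym (label-depth y)))
    (Reach-bundles 0<N depth)

-- A partition onto `Fin (suc i)` needs a vertex, so the construction cannot start here; without
-- vertices all requirements are vacuous.
stw-empty : ∀ H {w} → size H ≡ 0 → StwAtMost H w
stw-empty record { size = zero } refl = idₚ , record
  { P = λ i _ → zero
  ; surj = λ i ()
  ; singleton = λ i ()
  ; merge = λ i ()
  } , λ i ()

theorem6 : (G : Graph) (n m d : ℕ) →
    size G ≡ n → numEdges G ≡ m → maxDegree G ≡ d →
    (H : Graph) → IsSubdivisionAtLeast (n * 2 ^ m) G H →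
    StwAtMost H (32 * (4 * d + 5) ^ 3)
theorem6 G n m d refl refl _ H (ℓ , long , f , adj⇔) with size H ℕ.≟ 0
... | yes N≡0 = stw-empty H N≡0
... | no N≢0 = Subdivision.stw G ℓ (numEdges G) (edgeIndex G) (edgeIndex<numEdges G)
  (edgeIndex-injective G) long H f (λ x y → Equivalence.to (adj⇔ x y)) _
  -- At degree 0 the bound is 32 * 5^3 = 4000 = 72 + 3928, and it grows with `d`.
  (≤-trans (m≤m+n 72 3928) (*-monoʳ-≤ 32 (^-monoˡ-≤ 3 (m≤n+m 5 (4 * d)))))
  (n≢0⇒n>0 N≢0)
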